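{- Let $\pi:E\to[n]$ be a surjection from a finite set $E$ with $|\pi^{ -1}(i)|\ge2$ for every $i$, and let $S\subseteq E$ be a nonempty $\pi$-colored set. The outward-support coefficients of $e_S+(-\mathsf F_S)$ restrict to $\mathrm h_S^\pi$. Equivalently, $$-h(\mathsf F_S-e_S,e_R)=\mathrm h_S^\pi(e_R)$$ for every nonempty $\pi$-colored set $R\subseteq E$.
   Context: Put $E_i=\pi^{ -1}(i)$. For $T\subseteq E$, $e_T=\sum_{s\in T}e_s\in\mathbb R^E$. A set $S\subseteq E$ is $\pi$-colored if $|S\cap E_i|\le1$ for every $i$. For nonempty $\pi$-colored sets $S,R$, $\mathrm h_S^\pi(e_R)=1$ if $S\cap R\ne\emptyset$ and $0$ otherwise. (The vectors $e_R$ generate the rays of the $\pi$-colored fan, whose cones are $\operatorname{Cone}(e_{S_1},\dots,e_{S_k})$ for chains $S_1\subsetneq\dots\subsetneq S_k$ of nonempty $\pi$-colored sets, taken modulo $\operatorname{Span}\{e_{E_1},\dots,e_{E_n}\}$.) Support functions are $h(\mathsf Q,u)=\min_{x\in\mathsf Q}u\cdot x$; the outward support function is $h_{\max}(\mathsf Q,u)=\max_{x\in\mathsf Q}u\cdot x$, so $h_{\max}(-\mathsf Q,u)=-h(\mathsf Q,u)$; its values at the $e_R$ are the outward-support coefficients. For a nonempty $\pi$-colored $S$ let $I(S)=\{i : S\cap E_i\neq\emptyset\}$, $\mathbf E_S=(E_i)_{i\in I(S)}$, and $\Delta(\mathbf E_S)=\prod_{i\in I(S)}\operatorname{conv}\{e_s:s\in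 E_i\}\subset\mathbb R^E$ (zero in the other coordinates). The point $e_S$ is a vertex of $\Delta(\mathbf E_S)$, and $\mathsf F_S=\operatorname{Fr}[\Delta(\mathbf E_S),\{e_S\}]$ is the fragment of this vertex: $$\mathsf F_S=\Big\{x\in\Delta(\mathbf E_S) : \sum_{i\in I(S)}\ \sum_{t\in E_i\setminus S}x(t)\le1\Big\},$$ equivalently the convex hull of $e_S$ and the vertices of $\Delta(\mathbf E_S)$ adjacent to it. -}

module Defs where

open import Level using (Level; _⊔_; suc)
open import Algebra.Apartness.Bundles using (HeytingField; HeytingCommutativeRing)
open import Algebra.Bundles using (CommutativeRing)
import Algebra.Properties.Semiring.Sum as SemiringSum
open import Data.Bool.Base using (if_then_else_)
open import Data.Fin.Base using (Fin)
open import Data.Fin.Properties using (_≟_)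
open import Data.Fin.Subset using (Subset; ∣_∣; _∩_; _─_)
  renaming (_∈_ to _∈ˢ_)
open import Data.Fin.Subset.Properties using (_∈?_; nonempty?)
open import Data.Nat.Base as ℕ using (ℕ)
open import Data.Product.Base using (∃; ∃-syntax; _×_)
open import Data.Sum.Base using (_⊎_)
import Data.Vec.Base as Vec
open import Data.Vec.Functional using (Vector; map; zipWith)
open import Function.Bundles using (_⇔_)
open import Relation.Binary.Core using (Rel)
open import Relation.Binary.Structures using (IsStrictPartialOrder)
open import Relation.Nullary.Decidable.Core using (does)
open import Relation.Nullary.Negation.Core using (¬_)
open import Relation.Unary using (Pred; _∈_)

-- The library has no real numbers, so the scalars are an arbitrary ordered
-- field.  Writing `x ≤ y` as `¬ (y < x)` and taking apartness (rather than
-- trichotomy) as the source of linearity makes both the classical and the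
-- constructive real numbers, as well as ℚ, instances.
record OrderedField c ℓ₁ ℓ₂ ℓ₃ : Set (suc (c ⊔ ℓ₁ ⊔ ℓ₂ ⊔ ℓ₃)) where
  infix 4 _<_ _≤_
  field
    heytingField : HeytingField c ℓ₁ ℓ₂

  open HeytingField heytingField public

  field
    _<_                  : Rel Carrier ℓ₃
    isStrictPartialOrder : IsStrictPartialOrder _≈_ _<_
    #⇔<⊎>                : ∀ {x y} → (x # y) ⇔ (x < y ⊎ y < x)
    +-monoˡ-<            : ∀ {x y} z → x < y → x + z < y + z
    *-pos                : ∀ {x y} → 0# < x → 0# < y → 0# < x * y

  _≤_ : Rel Carrier ℓ₃
  x ≤ y = ¬ (y < x)

  commutativeRing : CommutativeRing c ℓ₁
  commutativeRing =
    HeytingCommutativeRing.commutativeRing heytingCommutativeRing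

-- The ground set E is `Fin m`, and [n] is `Fin n`.
module Colouring {m n : ℕ} (π : Fin m → Fin n) where

  fibre : Fin n → Subset m
  fibre i = Vec.tabulate λ s → does (π s ≟ i)

  Coloured : Subset m → Set
  Coloured S = ∀ i → ∣ S ∩ fibre i ∣ ℕ.≤ 1

  -- I(S)
  colours : Subset m → Subset n
  colours S = Vec.tabulate λ i → does (nonempty? (S ∩ fibre i))

module Polyhedra {c ℓ₁ ℓ₂ ℓ₃} (K : OrderedField c ℓ₁ ℓ₂ ℓ₃) where

  open OrderedField K
  open SemiringSum (CommutativeRing.semiring commutativeRing) public using (sum)

  private variable
    m : ℕ
    ℓ : Level

  infix 4 _≋_
  _≋_ : Rel (Vector Carrier m) ℓ₁
  x ≋ y = ∀ t → x t ≈ y t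

  infixl 7 _·_
  _·_ : Vector Carrier m → Vector Carrier m → Carrier
  u · x = sum λ t → u t * x t

  infixl 6 _+ᵛ_
  _+ᵛ_ : Vector Carrier m → Vector Carrier m → Vector Carrier m
  _+ᵛ_ = zipWith _+_

  infix 8 -ᵛ_
  -ᵛ_ : Vector Carrier m → Vector Carrier m
  -ᵛ_ = map (-_)

  sumOver : Subset m → (Fin m → Carrier) → Carrier
  sumOver A f = sum λ t → if does (t ∈? A) then f t else 0#

  basis : Fin m → Vector Carrier m
  basis s t = if does (s ≟ t) then 1# else 0#

  e : Subset m → Vector Carrier m
  e T t = sumOver T λ s → basis s t

  -- Coordinate projection onto K^A, regarded as a subspace of K^E.
  restrict : Subset m → Vector Carrier m → Vector Carrier m
  restrict A x t = if does (t ∈? A) then x t else 0#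

  conv : Pred (Vector Carrier m) ℓ → Pred (Vector Carrier m) (c ⊔ ℓ₁ ⊔ ℓ₃ ⊔ ℓ)
  conv {m = m} P x =
    ∃[ k ] ∃ λ (p : Fin k → Vector Carrier m) → ∃ λ (a : Vector Carrier k) →
      (∀ j → p j ∈ P) × (∀ j → 0# ≤ a j) × (sum a ≈ 1#) ×
      (x ≋ λ t → sum λ j → a j * p j t)

  infixl 6 _+ˢ_
  _+ˢ_ : Vector Carrier m → Pred (Vector Carrier m) ℓ →
         Pred (Vector Carrier m) (c ⊔ ℓ₁ ⊔ ℓ)
  (v +ˢ Q) y = ∃ λ x → x ∈ Q × y ≋ v +ᵛ x

  infix 8 -ˢ_
  -ˢ_ : Pred (Vector Carrier m) ℓ → Pred (Vector Carrier m) (c ⊔ ℓ₁ ⊔ ℓ)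
  (-ˢ Q) y = ∃ λ x → x ∈ Q × y ≋ -ᵛ x

  -- h(Q,u) = v.  A relation rather than a function, since the minimum
  -- need not exist for arbitrary Q; likewise for the maximum.
  Support : Pred (Vector Carrier m) ℓ → Vector Carrier m → Carrier →
            Set (c ⊔ ℓ₁ ⊔ ℓ₃ ⊔ ℓ)
  Support Q u v =
    (∃ λ x → x ∈ Q × u · x ≈ v) × (∀ x → x ∈ Q → v ≤ u · x)

  -- h_max(Q,u) = v
  OutwardSupport : Pred (Vector Carrier m) ℓ → Vector Carrier m → Carrier →
                   Set (c ⊔ ℓ₁ ⊔ ℓ₃ ⊔ ℓ)
  OutwardSupport Q u v =
    (∃ λ x → x ∈ Q × u · x ≈ v) × (∀ x → x ∈ Q → u · x ≤ v)

module Fragments {c ℓ₁ ℓ₂ ℓ₃} (K : OrderedField c ℓ₁ ℓ₂ ℓ₃)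
                 {m n : ℕ} (π : Fin m → Fin n) where

  open OrderedField K
  open Colouring π
  open Polyhedra K

  -- conv {e_s : s ∈ E_i}
  simplex : Fin n → Pred (Vector Carrier m) (c ⊔ ℓ₁ ⊔ ℓ₃)
  simplex i = conv λ p → ∃ λ s → s ∈ˢ fibre i × p ≋ basis s

  -- The product Δ(E_S) = ∏_{i ∈ I(S)} simplex i: the coordinates of K^E are
  -- the disjoint union of the fibres, so a point of K^E lies in the product
  -- when its projection to each K^(E_i), i ∈ I(S), lies in the i-th factor
  -- and all its other coordinates vanish.
  Δ : Subset m → Pred (Vector Carrier m) (c ⊔ ℓ₁ ⊔ ℓ₃)
  Δ S x =
    (∀ i → i ∈ˢ colours S → restrict (fibre i) x ∈ simplex i) ×
    (∀ t → ¬ (π t ∈ˢ colours S) → x t ≈ 0#)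

  -- F_S = Fr[Δ(E_S), {e_S}]
  F : Subset m → Pred (Vector Carrier m) (c ⊔ ℓ₁ ⊔ ℓ₃)
  F S x = x ∈ Δ S ×
    sumOver (colours S) (λ i → sumOver (fibre i ─ S) x) ≤ 1#

  -- The value h_S^π(e_R).
  hπ : Subset m → Subset m → Carrier
  hπ S R = if does (nonempty? (S ∩ R)) then 1# else 0#

module Submission where

-- Both assertions say that the maximum over x in F_S of e_R · (e_S - x) is
-- h_S(e_R): the outward support function of e_S + (-F_S) at e_R is this maximum
-- by definition, and reflecting in the origin turns it into minus the minimum
-- over F_S - e_S (`outwardSupport-translate`, `support-translate`).
--
-- The upper bound (`pairing≤hπ`) rests on one identity.  Let x lie in Δ(E_S)
-- and let s be the element of S of colour i.  The coordinates of x over E_i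
-- sum to 1, so 1 - x(s) is the sum of x(t) over t in E_i not in S.  Summed over
-- the colours of S (`escape`), it says that the left-hand side of the
-- inequality defining F_S is the total deficit, the sum of 1 - x(s) over s in
-- S; on F_S this deficit is at most 1.  Now e_R · (e_S - x) is the sum over t
-- in R of 1 - x(t) for t in S and of -x(t) for t outside S.  The latter terms
-- are at most 0 and the former at least 0, so the sum is at most the total
-- deficit, hence at most 1, and it is at most 0 if R misses S.
--
-- For attainment (`pairing-attains-hπ`), take x = e_S if R misses S, which
-- gives the value 0.  If R meets S in r, choose t different from r in the
-- fibre of r, which is possible because fibres have at least two elements, and
-- take x = e_S - e_r + e_t.  Its total deficit is 1, so it lies in F_S
-- (`exchange∈F`); and R, being coloured, contains r but not t, so the pairing
-- equals 1.

open import Defs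
open import Algebra.Bundles using (CommutativeRing)
import Algebra.Properties.Ring as RingProperties
import Algebra.Properties.Semiring.Sum as SemiringSum
open import Data.Bool.Base using (true; false; if_then_else_)
open import Data.Nat.Base as ℕ using (ℕ)
import Data.Nat.Properties as ℕ
open import Data.Fin.Base using (Fin; zero; suc; punchIn)
open import Data.Fin.Properties using (_≟_; punchInᵢ≢i)
open import Data.Fin.Subset using (Subset; Nonempty; ∣_∣; _∩_; _─_; ⁅_⁆)
  renaming (_∈_ to _∈ˢ_; _∉_ to _∉ˢ_)
open import Data.Fin.Subset.Properties
open import Data.Product.Base using (∃; _×_; _,_)
open import Data.Sum.Base using (inj₁; inj₂)
open import Data.Vec.Base using (tabulate; _∷_; here; there)
open import Data.Vec.Functional using (Vector)
open import Data.Vec.Properties using (lookup⇒[]=; []=⇒lookup; lookup∘tabulate)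
open import Function.Base using (_∘_)
open import Function.Bundles using (Equivalence)
open import Function.Definitions using (Surjective)
open import Level using (Level)
open import Relation.Binary.Bundles using (Preorder)
open import Relation.Binary.PropositionalEquality.Core as ≡ using (_≡_; _≢_)
import Relation.Binary.Reasoning.Preorder as PreorderReasoning
open import Relation.Binary.Structures using (IsStrictPartialOrder)
open import Relation.Nullary.Decidable.Core using (Dec; does; yes; no)
open import Relation.Nullary.Negation.Core using (¬_; contradiction)
open import Relation.Unary using (_∈_)

-- Finite subsets

private variable
  m : ℕ
  p : Level

-- `fibre` and `colours` are tabulated from decision procedures; these two
-- lemmas pass between membership in such a subset and the predicate.
∈-tabulate⁺ : {P : Fin m → Set p} (P? : ∀ i → Dec (P i)) {i : Fin m} →
              P i → i ∈ˢ tabulate (does ∘ P?)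
∈-tabulate⁺ P? {i} Pi with P? i in eq
... | yes _  = lookup⇒[]= i _ (≡.trans (lookup∘tabulate _ i) (≡.cong does eq))
... | no ¬Pi = contradiction Pi ¬Pi

∈-tabulate⁻ : {P : Fin m → Set p} (P? : ∀ i → Dec (P i)) {i : Fin m} →
              i ∈ˢ tabulate (does ∘ P?) → P i
∈-tabulate⁻ P? {i} i∈ with P? i in eq
... | yes Pi = Pi
... | no _
  with () ← ≡.trans (≡.sym ([]=⇒lookup i∈))
                    (≡.trans (lookup∘tabulate _ i) (≡.cong does eq))

x∈p─q⇒x∉q : ∀ (p q : Subset m) {x} → x ∈ˢ p ─ q → x ∉ˢ q
x∈p─q⇒x∉q (_ ∷ p) (_ ∷ q) (there x∈) (there x∈q) = x∈p─q⇒x∉q p q x∈ x∈q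
x∈p─q⇒x∉q (true  ∷ _) (true ∷ _) () here
x∈p─q⇒x∉q (false ∷ _) (true ∷ _) () here

∣p∣≤1⇒unique : ∀ {A : Subset m} → ∣ A ∣ ℕ.≤ 1 →
               ∀ {s t} → s ∈ˢ A → t ∈ˢ A → s ≡ t
∣p∣≤1⇒unique {A = A} ∣A∣≤1 {s} {t} s∈A t∈A with s ≟ t
... | yes s≡t = s≡t
... | no  s≢t = contradiction 1<∣A∣ (ℕ.≤⇒≯ ∣A∣≤1)
  where
  t∈A-s : t ∈ˢ A ─ ⁅ s ⁆
  t∈A-s = x∈p∧x≢y⇒x∈p-y t∈A (s≢t ∘ ≡.sym)
  1<∣A∣ : 1 ℕ.< ∣ A ∣
  1<∣A∣ = ℕ.<-≤-trans
    (ℕ.s≤s (ℕ.≤-<-trans ℕ.z≤n (x∈p⇒∣p-x∣<∣p∣ t∈A-s)))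
    (x∈p⇒∣p-x∣<∣p∣ s∈A)

2≤∣p∣⇒∃≢ : ∀ {A : Subset m} → 2 ℕ.≤ ∣ A ∣ → ∀ s → ∃ λ t → t ∈ˢ A × t ≢ s
2≤∣p∣⇒∃≢ {A = A} 2≤∣A∣ s with nonempty? (A ─ ⁅ s ⁆)
... | yes (t , t∈A-s) =
  t , p─q⊆p A ⁅ s ⁆ t∈A-s ,
  λ { ≡.refl → x∈p─q⇒x∉q A ⁅ s ⁆ t∈A-s (x∈⁅x⁆ s) }
... | no empty = contradiction ∣A∣≤1 (ℕ.<⇒≱ 2≤∣A∣)
  where
  A⊆⁅s⁆ : ∀ {t} → t ∈ˢ A → t ∈ˢ ⁅ s ⁆
  A⊆⁅s⁆ {t} t∈A with t ≟ s
  ... | yes ≡.refl = x∈⁅x⁆ s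
  ... | no  t≢s    = contradiction (t , x∈p∧x≢y⇒x∈p-y t∈A t≢s) empty
  ∣A∣≤1 : ∣ A ∣ ℕ.≤ 1
  ∣A∣≤1 = ℕ.≤-trans (p⊆q⇒∣p∣≤∣q∣ A⊆⁅s⁆) (ℕ.≤-reflexive (∣⁅x⁆∣≡1 s))

-- Ordered fields

module OrderedFieldProperties {c ℓ₁ ℓ₂ ℓ₃} (K : OrderedField c ℓ₁ ℓ₂ ℓ₃) where

  open OrderedField K
  open RingProperties (CommutativeRing.ring commutativeRing) public
  private module < = IsStrictPartialOrder isStrictPartialOrder

  ≤-reflexive : ∀ {x y} → x ≈ y → x ≤ y
  ≤-reflexive x≈y y<x = <.irrefl (sym x≈y) y<x

  -- The order is not assumed decidable.  A strict inequality z < x makes z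
  -- and x apart, and cotransitivity of apartness compares one of them with y.
  ≤-trans : ∀ {x y z} → x ≤ y → y ≤ z → x ≤ z
  ≤-trans {x} {y} {z} x≤y y≤z z<x
    with #-cotrans (Equivalence.from #⇔<⊎> (inj₁ z<x)) y
  ≤-trans x≤y y≤z z<x | inj₁ z#y with Equivalence.to #⇔<⊎> z#y
  ... | inj₁ z<y = y≤z z<y
  ... | inj₂ y<z = x≤y (<.trans y<z z<x)
  ≤-trans x≤y y≤z z<x | inj₂ y#x with Equivalence.to #⇔<⊎> y#x
  ... | inj₁ y<x = x≤y y<x
  ... | inj₂ x<y = y≤z (<.trans z<x x<y)

  ≤-preorder : Preorder c ℓ₁ ℓ₃
  ≤-preorder = record
    { _≈_ = _≈_
    ; _≲_ = _≤_
    ; isPreorder = record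
      { isEquivalence = isEquivalence
      ; reflexive = ≤-reflexive
      ; trans = ≤-trans
      }
    }

  open PreorderReasoning ≤-preorder

  +-monoˡ-≤ : ∀ {x y} z → x ≤ y → x + z ≤ y + z
  +-monoˡ-≤ {x} {y} z x≤y y+z<x+z =
    x≤y (<.<-respˡ-≈ (//-rightDividesʳ z y)
          (<.<-respʳ-≈ (//-rightDividesʳ z x) (+-monoˡ-< (- z) y+z<x+z)))

  +-mono-≤ : ∀ {x y u v} → x ≤ y → u ≤ v → x + u ≤ y + v
  +-mono-≤ {x} {y} {u} {v} x≤y u≤v = begin
    x + u ≲⟨ +-monoˡ-≤ u x≤y ⟩
    y + u ≈⟨ +-comm y u ⟩
    u + y ≲⟨ +-monoˡ-≤ y u≤v ⟩
    v + y ≈⟨ +-comm v y ⟩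
    y + v ∎

  x≤y⇒0≤y-x : ∀ {x y} → x ≤ y → 0# ≤ y - x
  x≤y⇒0≤y-x {x} {y} x≤y = begin
    0#    ≈⟨ -‿inverseʳ x ⟨
    x - x ≲⟨ +-monoˡ-≤ (- x) x≤y ⟩
    y - x ∎

  -‿anti-≤ : ∀ {x y} → x ≤ y → - y ≤ - x
  -‿anti-≤ {x} {y} x≤y = begin
    - y             ≈⟨ +-identityˡ (- y) ⟨
    0# - y          ≲⟨ +-monoˡ-≤ (- y) (x≤y⇒0≤y-x x≤y) ⟩
    (y - x) - y     ≈⟨ xyx⁻¹≈y y (- x) ⟩
    - x             ∎

  0≤x⇒y-x≤y : ∀ {x} y → 0# ≤ x → y - x ≤ y
  0≤x⇒y-x≤y {x} y 0≤x = begin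
    y - x      ≲⟨ +-mono-≤ (≤-reflexive refl) (-‿anti-≤ 0≤x) ⟩
    y - 0#     ≈⟨ +-congˡ -0#≈0# ⟩
    y + 0#     ≈⟨ +-identityʳ y ⟩
    y          ∎

  -- If 1 were negative, then 1 = (-1)(-1) would be positive.
  0≤1 : 0# ≤ 1#
  0≤1 1<0 = <.asym 1<0 (<.<-respʳ-≈ square (*-pos 0<-1 0<-1))
    where
    0<-1 : 0# < - 1#
    0<-1 = <.<-respˡ-≈ (-‿inverseʳ 1#)
             (<.<-respʳ-≈ (+-identityˡ _) (+-monoˡ-< (- 1#) 1<0))
    square : - 1# * - 1# ≈ 1#
    square = trans (-1*x≈-x (- 1#)) (-‿involutive 1#)

  a-[a+[b-c]]≈c-b : ∀ a b c → a - (a + (b - c)) ≈ c - b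
  a-[a+[b-c]]≈c-b a b c = begin-equality
    a - (a + (b - c))     ≈⟨ +-congˡ (-‿+-comm a (b - c)) ⟨
    a + (- a - (b - c))   ≈⟨ \\-leftDividesˡ a _ ⟩
    - (b - c)             ≈⟨ ⁻¹-anti-homo‿- b c ⟩
    c - b                 ∎

-- Sums, standard vectors, the pairing, and support functions

module PolyhedraProperties {c ℓ₁ ℓ₂ ℓ₃} (K : OrderedField c ℓ₁ ℓ₂ ℓ₃) where

  open OrderedField K hiding (zero)
  open OrderedFieldProperties K
  open Polyhedra K
  open SemiringSum (CommutativeRing.semiring commutativeRing) public
    using (sum-cong-≋; sum-replicate-zero; sum-remove; ∑-distrib-+; ∑-comm;
           *-distribˡ-sum)
  open PreorderReasoning ≤-preorder

  -- The two rules for values cut off outside a decidable set, the form shared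
  -- by `basis`, `restrict`, the terms of `sumOver`, and `hπ`.
  if-yes : ∀ {P : Set p} (P? : Dec P) {x} → P →
           (if does P? then x else 0#) ≈ x
  if-yes (yes _) _  = refl
  if-yes (no ¬P) P = contradiction P ¬P

  if-no : ∀ {P : Set p} (P? : Dec P) {x} → ¬ P →
          (if does P? then x else 0#) ≈ 0#
  if-no (yes P) ¬P = contradiction P ¬P
  if-no (no _)  _  = refl

  sum-zero : (f : Vector Carrier m) → (∀ t → f t ≈ 0#) → sum f ≈ 0#
  sum-zero {m} f f≈0 = trans (sum-cong-≋ f≈0) (sum-replicate-zero m)

  sum-single : (s : Fin m) (f : Vector Carrier m) →
               (∀ t → s ≢ t → f t ≈ 0#) → sum f ≈ f s
  sum-single {ℕ.suc _} s f f≈0 = begin-equality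
    sum f                              ≈⟨ sum-remove {i = s} f ⟩
    f s + sum (f ∘ punchIn s)          ≈⟨ +-congˡ (sum-zero _ λ j → f≈0 _ (punchInᵢ≢i s j ∘ ≡.sym)) ⟩
    f s + 0#                           ≈⟨ +-identityʳ (f s) ⟩
    f s                                ∎

  sum-mono-≤ : {f g : Vector Carrier m} → (∀ t → f t ≤ g t) → sum f ≤ sum g
  sum-mono-≤ {ℕ.zero}  _   = ≤-reflexive refl
  sum-mono-≤ {ℕ.suc _} f≤g = +-mono-≤ (f≤g zero) (sum-mono-≤ (f≤g ∘ suc))

  0≤sum : (f : Vector Carrier m) → (∀ t → 0# ≤ f t) → 0# ≤ sum f
  0≤sum {m} f 0≤f = begin
    0#             ≈⟨ sum-replicate-zero m ⟨
    sum {m} (λ _ → 0#) ≲⟨ sum-mono-≤ 0≤f ⟩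
    sum f          ∎

  f≤sum : (f : Vector Carrier m) → (∀ t → 0# ≤ f t) → ∀ s → f s ≤ sum f
  f≤sum {ℕ.suc _} f 0≤f s = begin
    f s                       ≈⟨ +-identityʳ (f s) ⟨
    f s + 0#                  ≲⟨ +-mono-≤ (≤-reflexive refl) (0≤sum _ λ j → 0≤f (punchIn s j)) ⟩
    f s + sum (f ∘ punchIn s) ≈⟨ sum-remove {i = s} f ⟨
    sum f                     ∎

  basis-diag : (s : Fin m) → basis s s ≈ 1#
  basis-diag s = if-yes (s ≟ s) ≡.refl

  basis-off : (s t : Fin m) → s ≢ t → basis s t ≈ 0#
  basis-off s t = if-no (s ≟ t)

  0≤basis : (s t : Fin m) → 0# ≤ basis s t
  0≤basis s t with does (s ≟ t)
  ... | true  = 0≤1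
  ... | false = ≤-reflexive refl

  sum-basis : (s : Fin m) → sum (basis s) ≈ 1#
  sum-basis s = trans (sum-single s (basis s) (basis-off s)) (basis-diag s)

  e-∈ : {T : Subset m} {t : Fin m} → t ∈ˢ T → e T t ≈ 1#
  e-∈ {T = T} {t} t∈T = begin-equality
    e T t ≈⟨ sum-single t _ (λ s t≢s → off s (t≢s ∘ ≡.sym)) ⟩
    (if does (t ∈? T) then basis t t else 0#) ≈⟨ if-yes (t ∈? T) t∈T ⟩
    basis t t ≈⟨ basis-diag t ⟩
    1# ∎
    where
    off : ∀ s → s ≢ t → (if does (s ∈? T) then basis s t else 0#) ≈ 0#
    off s s≢t with does (s ∈? T)
    ... | true  = basis-off s t s≢t
    ... | false = refl

  e-∉ : {T : Subset m} {t : Fin m} → t ∉ˢ T → e T t ≈ 0#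
  e-∉ {T = T} {t} t∉T = sum-zero _ off
    where
    off : ∀ s → (if does (s ∈? T) then basis s t else 0#) ≈ 0#
    off s with s ∈? T
    ... | yes s∈T = basis-off s t λ { ≡.refl → t∉T s∈T }
    ... | no _    = refl

  ·-cong : {u v w : Vector Carrier m} → v ≋ w → u · v ≈ u · w
  ·-cong v≋w = sum-cong-≋ λ t → *-congˡ (v≋w t)

  ·-+ᵛ : (u v w : Vector Carrier m) → u · (v +ᵛ w) ≈ u · v + u · w
  ·-+ᵛ u v w = trans (sum-cong-≋ λ t → distribˡ (u t) (v t) (w t))
                     (∑-distrib-+ (λ t → u t * v t) (λ t → u t * w t))

  ·--ᵛ : (u v : Vector Carrier m) → u · (-ᵛ v) ≈ - (u · v)
  ·--ᵛ u v = begin-equality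
    u · (-ᵛ v)                       ≈⟨ sum-cong-≋ pointwise ⟩
    sum (λ t → - 1# * (u t * v t))   ≈⟨ *-distribˡ-sum (- 1#) (λ t → u t * v t) ⟨
    - 1# * (u · v)                   ≈⟨ -1*x≈-x (u · v) ⟩
    - (u · v)                        ∎
    where
    pointwise : ∀ t → u t * - v t ≈ - 1# * (u t * v t)
    pointwise t = trans (sym (-‿distribʳ-* (u t) (v t)))
                        (sym (-1*x≈-x (u t * v t)))

  ·-basis : (u : Vector Carrier m) (s : Fin m) → u · basis s ≈ u s
  ·-basis u s = begin-equality
    u · basis s     ≈⟨ sum-single s _ (λ t s≢t → trans (*-congˡ (basis-off s t s≢t)) (zeroʳ (u t))) ⟩
    u s * basis s s ≈⟨ *-congˡ (basis-diag s) ⟩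
    u s * 1#        ≈⟨ *-identityʳ (u s) ⟩
    u s             ∎

  e-· : (R : Subset m) (v : Vector Carrier m) → e R · v ≈ sumOver R v
  e-· R v = sum-cong-≋ pointwise
    where
    pointwise : ∀ t → e R t * v t ≈ (if does (t ∈? R) then v t else 0#)
    pointwise t with t ∈? R
    ... | yes t∈R = trans (*-congʳ (e-∈ t∈R)) (*-identityˡ (v t))
    ... | no  t∉R = trans (*-congʳ (e-∉ t∉R)) (zeroˡ (v t))

  -- It suffices to maximise u · (v - x) over x in Q.
  outwardSupport-translate : ∀ {ℓ} {Q : Vector Carrier m → Set ℓ} {u v b} →
    (∃ λ x → x ∈ Q × u · (v +ᵛ -ᵛ x) ≈ b) →
    (∀ {x} → x ∈ Q → u · (v +ᵛ -ᵛ x) ≤ b) →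
    OutwardSupport (v +ˢ (-ˢ Q)) u b
  outwardSupport-translate {u = u} {v} {b} (x , x∈Q , attained) bound =
    (v +ᵛ -ᵛ x , (-ᵛ x , (x , x∈Q , λ _ → refl) , λ _ → refl) , attained) ,
    λ { y (x′ , (x , x∈Q , x′≋) , y≋) → ≤-trans
        (≤-reflexive (·-cong {u = u} λ t → trans (y≋ t) (+-congˡ (x′≋ t))))
        (bound x∈Q) }

  -- The minimum of u over Q - v is minus the maximum of u · (v - x) over x
  -- in Q.
  support-translate : ∀ {ℓ} {Q : Vector Carrier m → Set ℓ} {u v b} →
    (∃ λ x → x ∈ Q × u · (v +ᵛ -ᵛ x) ≈ b) →
    (∀ {x} → x ∈ Q → u · (v +ᵛ -ᵛ x) ≤ b) →
    Support ((-ᵛ v) +ˢ Q) u (- b)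
  support-translate {u = u} {v} {b} (x , x∈Q , attained) bound =
    (-ᵛ v +ᵛ x , (x , x∈Q , λ _ → refl) , trans (reflect x) (-‿cong attained)) ,
    λ { y (x , x∈Q , y≋) → ≤-trans (-‿anti-≤ (bound x∈Q))
        (≤-reflexive (sym (trans (·-cong {u = u} y≋) (reflect x)))) }
    where
    reflect : ∀ x → u · (-ᵛ v +ᵛ x) ≈ - (u · (v +ᵛ -ᵛ x))
    reflect x = begin-equality
      u · (-ᵛ v +ᵛ x)
        ≈⟨ ·-cong {u = u} (λ t → trans (+-comm _ _) (sym (⁻¹-anti-homo‿- (v t) (x t)))) ⟩
      u · (-ᵛ (v +ᵛ -ᵛ x))  ≈⟨ ·--ᵛ u (v +ᵛ -ᵛ x) ⟩
      - (u · (v +ᵛ -ᵛ x))   ∎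

-- Fragments of vertices of products of simplices

module FragmentProperties {c ℓ₁ ℓ₂ ℓ₃} (K : OrderedField c ℓ₁ ℓ₂ ℓ₃)
                          {m n : ℕ} (π : Fin m → Fin n) where

  open OrderedField K hiding (zero)
  open OrderedFieldProperties K
  open Colouring π
  open Polyhedra K
  open PolyhedraProperties K
  open Fragments K π
  open PreorderReasoning ≤-preorder

  ∈-fibre⁺ : ∀ {i t} → π t ≡ i → t ∈ˢ fibre i
  ∈-fibre⁺ {i} = ∈-tabulate⁺ (λ s → π s ≟ i)

  ∈-fibre⁻ : ∀ {i t} → t ∈ˢ fibre i → π t ≡ i
  ∈-fibre⁻ {i} = ∈-tabulate⁻ (λ s → π s ≟ i)

  coloured-unique : ∀ {S} → Coloured S → ∀ {s t} → s ∈ˢ S → t ∈ˢ S →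
                    π s ≡ π t → s ≡ t
  coloured-unique coloured s∈S t∈S πs≡πt =
    ∣p∣≤1⇒unique (coloured _)
      (x∈p∩q⁺ (s∈S , ∈-fibre⁺ πs≡πt)) (x∈p∩q⁺ (t∈S , ∈-fibre⁺ ≡.refl))

  ∈-colours⁺ : ∀ {S s} → s ∈ˢ S → π s ∈ˢ colours S
  ∈-colours⁺ {S} s∈S = ∈-tabulate⁺ (λ i → nonempty? (S ∩ fibre i))
    (_ , x∈p∩q⁺ (s∈S , ∈-fibre⁺ ≡.refl))

  ∈-colours⁻ : ∀ {S i} → i ∈ˢ colours S → ∃ λ s → s ∈ˢ S × π s ≡ i
  ∈-colours⁻ {S} {i} i∈
    with s , s∈ ← ∈-tabulate⁻ (λ i → nonempty? (S ∩ fibre i)) i∈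
    with s∈S , s∈fibre ← x∈p∩q⁻ S (fibre i) s∈
    = s , s∈S , ∈-fibre⁻ s∈fibre

  sum-fibres : (f : Vector Carrier m) → sum f ≈ sum (λ i → sumOver (fibre i) f)
  sum-fibres f = begin-equality
    sum f                                  ≈⟨ sum-cong-≋ at ⟨
    sum (λ t → sum λ i → restrict (fibre i) f t) ≈⟨ ∑-comm (λ t i → restrict (fibre i) f t) ⟩
    sum (λ i → sumOver (fibre i) f)        ∎
    where
    at : ∀ t → sum (λ i → restrict (fibre i) f t) ≈ f t
    at t = trans
      (sum-single (π t) _ λ i πt≢i → if-no (t ∈? fibre i) (πt≢i ∘ ∈-fibre⁻))
      (if-yes (t ∈? fibre (π t)) (∈-fibre⁺ ≡.refl))

  simplex⇒0≤ : ∀ {i w} → w ∈ simplex i → ∀ t → 0# ≤ w t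
  simplex⇒0≤ {w = w} (_ , p , a , p∈ , 0≤a , _ , w≋) t = begin
    0#                           ≲⟨ 0≤sum _ term ⟩
    sum (λ j → a j * p j t)      ≈⟨ w≋ t ⟨
    w t                          ∎
    where
    -- The coordinates of a standard vector are 0 or 1, so monotonicity of
    -- multiplication is not needed.
    scaled : ∀ {y} s → 0# ≤ y → 0# ≤ y * basis s t
    scaled {y} s 0≤y with does (s ≟ t)
    ... | true  = ≤-trans 0≤y (≤-reflexive (sym (*-identityʳ y)))
    ... | false = ≤-reflexive (sym (zeroʳ y))
    term : ∀ j → 0# ≤ a j * p j t
    term j with s , _ , pj≋ ← p∈ j =
      ≤-trans (scaled s (0≤a j)) (≤-reflexive (*-congˡ (sym (pj≋ t))))

  simplex⇒sum≈1 : ∀ {i w} → w ∈ simplex i → sum w ≈ 1#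
  simplex⇒sum≈1 {w = w} (_ , p , a , p∈ , _ , ∑a≈1 , w≋) = begin-equality
    sum w                                     ≈⟨ sum-cong-≋ w≋ ⟩
    sum (λ t → sum (λ j → a j * p j t))       ≈⟨ ∑-comm (λ t j → a j * p j t) ⟩
    sum (λ j → sum (λ t → a j * p j t))       ≈⟨ sum-cong-≋ (λ j → *-distribˡ-sum (a j) (p j)) ⟨
    sum (λ j → a j * sum (p j))               ≈⟨ sum-cong-≋ (λ j → trans (*-congˡ (sum-p j)) (*-identityʳ (a j))) ⟩
    sum a                                     ≈⟨ ∑a≈1 ⟩
    1#                                        ∎
    where
    sum-p : ∀ j → sum (p j) ≈ 1#
    sum-p j with s , _ , pj≋ ← p∈ j = trans (sum-cong-≋ pj≋) (sum-basis s)

  basis⇒simplex : ∀ {i w s} → π s ≡ i → w ≋ basis s → w ∈ simplex i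
  basis⇒simplex {w = w} {s} πs≡i w≋ =
    1 , (λ _ → basis s) , (λ _ → 1#) ,
    (λ _ → s , ∈-fibre⁺ πs≡i , λ _ → refl) , (λ _ → 0≤1) , +-identityʳ 1# ,
    λ t → trans (w≋ t) (sym (trans (+-identityʳ _) (*-identityˡ (basis s t))))

  Δ⇒0≤ : ∀ {S x} → x ∈ Δ S → ∀ t → 0# ≤ x t
  Δ⇒0≤ {S} {x} (factors , vanish) t with π t ∈? colours S
  ... | no  πt∉ = ≤-reflexive (sym (vanish t πt∉))
  ... | yes πt∈ = ≤-trans (simplex⇒0≤ (factors (π t) πt∈) t)
                          (≤-reflexive (if-yes (t ∈? fibre (π t)) (∈-fibre⁺ ≡.refl)))

  Δ⇒≤1 : ∀ {S x} → x ∈ Δ S → ∀ {t} → π t ∈ˢ colours S → x t ≤ 1#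
  Δ⇒≤1 {S} {x} (factors , _) {t} πt∈ = begin
    x t                       ≈⟨ if-yes (t ∈? fibre (π t)) (∈-fibre⁺ ≡.refl) ⟨
    restrict (fibre (π t)) x t ≲⟨ f≤sum _ (simplex⇒0≤ factor) t ⟩
    sumOver (fibre (π t)) x   ≈⟨ simplex⇒sum≈1 factor ⟩
    1#                        ∎
    where factor = factors (π t) πt∈

  -- The shortfall of x from e_S in the coordinates indexed by S, and zero in
  -- the other coordinates.
  deficit : Subset m → Vector Carrier m → Vector Carrier m
  deficit S x = restrict S (λ t → 1# - x t)

  -- The point e_S - e_s + e_t.  When s lies in S and t has the colour of s, it
  -- is the vertex e_S itself (if t = s) or a vertex of Δ(E_S) adjacent to it.
  exchange : Subset m → Fin m → Fin m → Vector Carrier m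
  exchange S s t = e S +ᵛ (basis t +ᵛ -ᵛ basis s)

  -- For a linear functional u, only the exchanged coordinates contribute.
  pairing-exchange : ∀ S u s t → u · (e S +ᵛ -ᵛ exchange S s t) ≈ u s - u t
  pairing-exchange S u s t = begin-equality
    u · (e S +ᵛ -ᵛ exchange S s t)
      ≈⟨ ·-cong {u = u} (λ r → a-[a+[b-c]]≈c-b (e S r) (basis t r) (basis s r)) ⟩
    u · (basis s +ᵛ -ᵛ basis t)          ≈⟨ ·-+ᵛ u (basis s) (-ᵛ basis t) ⟩
    u · basis s + u · (-ᵛ basis t)       ≈⟨ +-congˡ (·--ᵛ u (basis t)) ⟩
    u · basis s - u · basis t            ≈⟨ +-cong (·-basis u s) (-‿cong (·-basis u t)) ⟩
    u s - u t                            ∎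

  module _ {S : Subset m} (coloured : Coloured S) where

    -- Adding the coordinates of x over the fibre, which sum to 1, turns both
    -- sides into sums that agree term by term: the coordinate at the unique
    -- element s of S in the fibre becomes 1, and every other coordinate in the
    -- fibre is that of x.
    fibre-escape : ∀ {x} → x ∈ Δ S → ∀ {s} → s ∈ˢ S →
      sumOver (fibre (π s)) (deficit S x) ≈ sumOver (fibre (π s) ─ S) x
    fibre-escape {x} (factors , _) {s} s∈S = +-cancelʳ 1# _ _ (begin-equality
      sumOver Eₛ (deficit S x) + 1#             ≈⟨ +-congˡ (simplex⇒sum≈1 (factors (π s) (∈-colours⁺ s∈S))) ⟨
      sumOver Eₛ (deficit S x) + sumOver Eₛ x   ≈⟨ ∑-distrib-+ (restrict Eₛ (deficit S x)) (restrict Eₛ x) ⟨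
      sum (λ t → restrict Eₛ (deficit S x) t + restrict Eₛ x t)
        ≈⟨ sum-cong-≋ (λ t → pointwise t (t ∈? Eₛ) (t ∈? S)) ⟩
      sum (λ t → restrict (Eₛ ─ S) x t + basis s t) ≈⟨ ∑-distrib-+ (restrict (Eₛ ─ S) x) (basis s) ⟩
      sumOver (Eₛ ─ S) x + sum (basis s)  ≈⟨ +-congˡ (sum-basis s) ⟩
      sumOver (Eₛ ─ S) x + 1#             ∎)
      where
      Eₛ : Subset m
      Eₛ = fibre (π s)
      pointwise : ∀ t → Dec (t ∈ˢ Eₛ) → Dec (t ∈ˢ S) →
        restrict Eₛ (deficit S x) t + restrict Eₛ x t ≈
        restrict (Eₛ ─ S) x t + basis s t
      pointwise t (yes t∈E) (yes t∈S)
        with ≡.refl ← coloured-unique coloured t∈S s∈S (∈-fibre⁻ t∈E) = begin-equality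
        restrict Eₛ (deficit S x) t + restrict Eₛ x t
          ≈⟨ +-cong (trans (if-yes (t ∈? Eₛ) t∈E) (if-yes (t ∈? S) t∈S)) (if-yes (t ∈? Eₛ) t∈E) ⟩
        (1# - x t) + x t       ≈⟨ //-rightDividesˡ (x t) 1# ⟩
        1#                     ≈⟨ +-identityˡ 1# ⟨
        0# + 1#
          ≈⟨ +-cong (if-no (t ∈? Eₛ ─ S) (λ t∈ → x∈p─q⇒x∉q Eₛ S t∈ t∈S)) (basis-diag t) ⟨
        restrict (Eₛ ─ S) x t + basis t t ∎
      pointwise t (yes t∈E) (no t∉S) = begin-equality
        restrict Eₛ (deficit S x) t + restrict Eₛ x t
          ≈⟨ +-cong (trans (if-yes (t ∈? Eₛ) t∈E) (if-no (t ∈? S) t∉S)) (if-yes (t ∈? Eₛ) t∈E) ⟩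
        0# + x t               ≈⟨ +-comm 0# (x t) ⟩
        x t + 0#
          ≈⟨ +-cong (if-yes (t ∈? Eₛ ─ S) (x∈p∧x∉q⇒x∈p─q t∈E t∉S)) (basis-off s t λ { ≡.refl → t∉S s∈S }) ⟨
        restrict (Eₛ ─ S) x t + basis s t ∎
      pointwise t (no t∉E) _ = begin-equality
        restrict Eₛ (deficit S x) t + restrict Eₛ x t
          ≈⟨ +-cong (if-no (t ∈? Eₛ) t∉E) (if-no (t ∈? Eₛ) t∉E) ⟩
        0# + 0#
          ≈⟨ +-cong (if-no (t ∈? Eₛ ─ S) (t∉E ∘ p─q⊆p Eₛ S)) (basis-off s t λ { ≡.refl → t∉E (∈-fibre⁺ ≡.refl) }) ⟨
        restrict (Eₛ ─ S) x t + basis s t ∎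

    -- The left-hand side of the inequality defining F_S, summed over elements
    -- outside S, equals the total deficit at the elements of S.
    escape : ∀ {x} → x ∈ Δ S →
      sum (deficit S x) ≈
      sumOver (colours S) (λ i → sumOver (fibre i ─ S) x)
    escape {x} x∈Δ = trans (sum-fibres _) (sum-cong-≋ λ i → go i (i ∈? colours S))
      where
      go : ∀ i → Dec (i ∈ˢ colours S) → sumOver (fibre i) (deficit S x) ≈
        (if does (i ∈? colours S) then sumOver (fibre i ─ S) x else 0#)
      go i (yes i∈) with s , s∈S , ≡.refl ← ∈-colours⁻ i∈ =
        trans (fibre-escape x∈Δ s∈S) (sym (if-yes (π s ∈? colours S) i∈))
      go i (no i∉) = trans (sum-zero _ vanish) (sym (if-no (i ∈? colours S) i∉))
        where
        vanish : ∀ t → restrict (fibre i) (deficit S x) t ≈ 0#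
        vanish t with t ∈? fibre i
        ... | no  _   = refl
        ... | yes t∈E = if-no (t ∈? S) λ t∈S →
          i∉ (≡.subst (_∈ˢ colours S) (∈-fibre⁻ t∈E) (∈-colours⁺ t∈S))

    pairing≤hπ : ∀ R {x} → x ∈ F S → e R · (e S +ᵛ -ᵛ x) ≤ hπ S R
    pairing≤hπ R {x} (x∈Δ , escape≤1) = go (nonempty? (S ∩ R))
      where
      go : Dec (Nonempty (S ∩ R)) → e R · (e S +ᵛ -ᵛ x) ≤ hπ S R
      go (yes S∩R≢∅) = begin
        e R · (e S +ᵛ -ᵛ x)            ≈⟨ e-· R _ ⟩
        sumOver R (e S +ᵛ -ᵛ x)        ≲⟨ sum-mono-≤ pointwise ⟩
        sum (deficit S x)              ≈⟨ escape x∈Δ ⟩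
        sumOver (colours S) (λ i → sumOver (fibre i ─ S) x) ≲⟨ escape≤1 ⟩
        1#                             ≈⟨ if-yes (nonempty? (S ∩ R)) S∩R≢∅ ⟨
        hπ S R                         ∎
        where
        pointwise : ∀ t → restrict R (e S +ᵛ -ᵛ x) t ≤
                          deficit S x t
        pointwise t with t ∈? R | t ∈? S
        ... | yes _ | yes t∈S = ≤-reflexive (+-congʳ (e-∈ t∈S))
        ... | yes _ | no  t∉S = ≤-trans (0≤x⇒y-x≤y (e S t) (Δ⇒0≤ x∈Δ t))
                                        (≤-reflexive (e-∉ t∉S))
        ... | no  _ | yes t∈S = x≤y⇒0≤y-x (Δ⇒≤1 x∈Δ (∈-colours⁺ t∈S))
        ... | no  _ | no  _   = ≤-reflexive refl
      go (no S∩R≡∅) = begin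
        e R · (e S +ᵛ -ᵛ x)            ≈⟨ e-· R _ ⟩
        sumOver R (e S +ᵛ -ᵛ x)        ≲⟨ sum-mono-≤ pointwise ⟩
        sum {m} (λ _ → 0#)             ≈⟨ sum-replicate-zero m ⟩
        0#                             ≈⟨ if-no (nonempty? (S ∩ R)) S∩R≡∅ ⟨
        hπ S R                         ∎
        where
        pointwise : ∀ t → restrict R (e S +ᵛ -ᵛ x) t ≤ 0#
        pointwise t with t ∈? R
        ... | no  _   = ≤-reflexive refl
        ... | yes t∈R = ≤-trans (0≤x⇒y-x≤y (e S t) (Δ⇒0≤ x∈Δ t))
          (≤-reflexive (e-∉ λ t∈S → S∩R≡∅ (t , x∈p∩q⁺ (t∈S , t∈R))))

    -- Over each colour that S uses, e_S is a single standard vector.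
    e-fibre : ∀ {s t} → s ∈ˢ S → π t ≡ π s → e S t ≈ basis s t
    e-fibre {s} {t} s∈S πt≡πs with s ≟ t
    ... | yes ≡.refl = e-∈ s∈S
    ... | no  s≢t    = e-∉ λ t∈S → s≢t (coloured-unique coloured s∈S t∈S (≡.sym πt≡πs))

    exchange∈Δ : ∀ {s t} → s ∈ˢ S → π t ≡ π s → exchange S s t ∈ Δ S
    exchange∈Δ {s} {t} s∈S πt≡πs = factors , vanish
      where
      unchanged : ∀ {r} → π r ≢ π s → exchange S s t r ≈ e S r
      unchanged {r} πr≢πs = begin-equality
        e S r + (basis t r - basis s r)
          ≈⟨ +-congˡ (+-cong (basis-off t r λ { ≡.refl → πr≢πs πt≡πs })
                             (-‿cong (basis-off s r λ { ≡.refl → πr≢πs ≡.refl }))) ⟩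
        e S r + (0# - 0#) ≈⟨ +-congˡ (-‿inverseʳ 0#) ⟩
        e S r + 0#        ≈⟨ +-identityʳ (e S r) ⟩
        e S r             ∎

      exchanged : ∀ {r} → π r ≡ π s → exchange S s t r ≈ basis t r
      exchanged {r} πr≡πs = begin-equality
        e S r + (basis t r - basis s r)     ≈⟨ +-comm _ _ ⟩
        (basis t r - basis s r) + e S r     ≈⟨ +-congˡ (e-fibre s∈S πr≡πs) ⟩
        (basis t r - basis s r) + basis s r ≈⟨ //-rightDividesˡ (basis s r) (basis t r) ⟩
        basis t r                           ∎

      restrict-basis : ∀ {x i s′} → π s′ ≡ i →
        (∀ {r} → π r ≡ i → x r ≈ basis s′ r) → restrict (fibre i) x ≋ basis s′
      restrict-basis {i = i} {s′} πs′≡i x≈ r with r ∈? fibre i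
      ... | yes r∈E = x≈ (∈-fibre⁻ r∈E)
      ... | no  r∉E = sym (basis-off s′ r λ { ≡.refl → r∉E (∈-fibre⁺ πs′≡i) })

      factors : ∀ i → i ∈ˢ colours S → restrict (fibre i) (exchange S s t) ∈ simplex i
      factors i i∈ with i ≟ π s
      ... | yes ≡.refl = basis⇒simplex πt≡πs (restrict-basis πt≡πs exchanged)
      ... | no  i≢πs with s′ , s′∈S , ≡.refl ← ∈-colours⁻ i∈ =
        basis⇒simplex ≡.refl (restrict-basis ≡.refl λ πr≡πs′ → trans
          (unchanged (i≢πs ∘ ≡.trans (≡.sym πr≡πs′))) (e-fibre s′∈S πr≡πs′))

      vanish : ∀ r → ¬ (π r ∈ˢ colours S) → exchange S s t r ≈ 0#
      vanish r πr∉ = trans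
        (unchanged λ πr≡πs → πr∉ (≡.subst (_∈ˢ colours S) (≡.sym πr≡πs) (∈-colours⁺ s∈S)))
        (e-∉ (πr∉ ∘ ∈-colours⁺))

    exchange∈F : ∀ {s t} → s ∈ˢ S → π t ≡ π s → exchange S s t ∈ F S
    exchange∈F {s} {t} s∈S πt≡πs = x∈Δ , (begin
      sumOver (colours S) (λ i → sumOver (fibre i ─ S) (exchange S s t)) ≈⟨ escape x∈Δ ⟨
      sum (deficit S (exchange S s t)) ≲⟨ sum-mono-≤ pointwise ⟩
      sum (basis s)                         ≈⟨ sum-basis s ⟩
      1#                                    ∎)
      where
      x∈Δ = exchange∈Δ s∈S πt≡πs
      pointwise : ∀ r → deficit S (exchange S s t) r ≤ basis s r
      pointwise r with r ∈? S
      ... | no  _   = 0≤basis s r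
      ... | yes r∈S = begin
        1# - exchange S s t r                           ≈⟨ +-congʳ (e-∈ r∈S) ⟨
        e S r - (e S r + (basis t r - basis s r))     ≈⟨ a-[a+[b-c]]≈c-b _ _ _ ⟩
        basis s r - basis t r                         ≲⟨ 0≤x⇒y-x≤y _ (0≤basis t r) ⟩
        basis s r                                     ∎

    pairing-attains-hπ : (∀ i → 2 ℕ.≤ ∣ fibre i ∣) → Nonempty S →
      ∀ {R} → Coloured R → ∃ λ x → x ∈ F S × e R · (e S +ᵛ -ᵛ x) ≈ hπ S R
    pairing-attains-hπ 2≤∣E∣ (s , s∈S) {R} R-coloured = go (nonempty? (S ∩ R))
      where
      go : Dec (Nonempty (S ∩ R)) → ∃ λ x → x ∈ F S × e R · (e S +ᵛ -ᵛ x) ≈ hπ S R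
      go (no S∩R≡∅) = exchange S s s , exchange∈F s∈S ≡.refl , (begin-equality
        e R · (e S +ᵛ -ᵛ exchange S s s) ≈⟨ pairing-exchange S (e R) s s ⟩
        e R s - e R s                  ≈⟨ -‿inverseʳ (e R s) ⟩
        0#                             ≈⟨ if-no (nonempty? (S ∩ R)) S∩R≡∅ ⟨
        hπ S R                         ∎)
      go (yes S∩R≢∅@(r , r∈S∩R))
        with r∈S , r∈R ← x∈p∩q⁻ S R r∈S∩R
        with t , t∈E , t≢r ← 2≤∣p∣⇒∃≢ (2≤∣E∣ (π r)) r =
        exchange S r t , exchange∈F r∈S πt≡πr , (begin-equality
        e R · (e S +ᵛ -ᵛ exchange S r t) ≈⟨ pairing-exchange S (e R) r t ⟩
        e R r - e R t                  ≈⟨ +-cong (e-∈ r∈R) (-‿cong (e-∉ t∉R)) ⟩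
        1# - 0#                        ≈⟨ +-congˡ -0#≈0# ⟩
        1# + 0#                        ≈⟨ +-identityʳ 1# ⟩
        1#                             ≈⟨ if-yes (nonempty? (S ∩ R)) S∩R≢∅ ⟨
        hπ S R                         ∎)
        where
        πt≡πr : π t ≡ π r
        πt≡πr = ∈-fibre⁻ t∈E
        t∉R : t ∉ˢ R
        t∉R t∈R = t≢r (coloured-unique R-coloured t∈R r∈R πt≡πr)

proposition8p8 : ∀ {c ℓ₁ ℓ₂ ℓ₃} (K : OrderedField c ℓ₁ ℓ₂ ℓ₃) {m n : ℕ} (π : Fin m → Fin n) →
  let open OrderedField K
      open Colouring π
      open Polyhedra K
      open Fragments K π
  in
  Surjective _≡_ _≡_ π →
  (∀ i → 2 ℕ.≤ ∣ fibre i ∣) →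
  (S : Subset m) → Nonempty S → Coloured S →
  (∀ (R : Subset m) → Nonempty R → Coloured R →
    OutwardSupport (e S +ˢ (-ˢ F S)) (e R) (hπ S R))
  ×
  (∀ (R : Subset m) → Nonempty R → Coloured R →
    ∃ λ v → Support ((-ᵛ e S) +ˢ F S) (e R) v × (- v) ≈ hπ S R)
proposition8p8 K π _ 2≤∣E∣ S S≢∅ S-coloured =
  (λ R _ R-coloured → outwardSupport-translate (attained R-coloured) (pairing≤hπ S-coloured R)) ,
  (λ R _ R-coloured → - hπ S R ,
    support-translate (attained R-coloured) (pairing≤hπ S-coloured R) ,
    -‿involutive (hπ S R))
  where
  open OrderedField K using (-_)
  open OrderedFieldProperties K using (-‿involutive)
  open Fragments K π using (hπ)
  open PolyhedraProperties K using (outwardSupport-translate; support-translate)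
  open FragmentProperties K π
  attained = pairing-attains-hπ S-coloured 2≤∣E∣ S≢∅
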